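{- Let $(L,\le,(\sqsubseteq_\alpha)_{\alpha<\kappa})$ be a model of Axioms 1–4. Then $(L,\sqsubseteq)$ is a complete lattice. More precisely, $\perp\sqsubseteq x$ for every $x\in L$, and every nonempty subset of $L$ has a least upper bound with respect to $\sqsubseteq$.
   Context: Setting (model of Axioms 1–4). Let $(L,\le)$ be a complete lattice with join operation $\bigvee$ and least element $\perp$. Let $\kappa>0$ be an ordinal, and for each ordinal $\alpha<\kappa$ let $\sqsubseteq_\alpha$ be a preorder (reflexive and transitive relation) on $L$. Derived relations: - $x=_\alpha y$ means $x\sqsubseteq_\alpha y$ and $y\sqsubseteq_\alpha x$. - $x\sqsubset_\alpha y$ means $x\sqsubseteq_\alpha y$ and not $x=_\alpha y$. - $\sqsubset=\bigcup_{\alpha<\kappa}\sqsubset_\alpha$. - $x\sqsubseteq y$ means $x\sqsubset y$ or $x=y$. Derived sets, for $x\in L$ and $\alpha<\kappa$: - $(x]_\alpha=\{y\in L:\forall\beta<\alpha,\ x=_\beta y\}$. - $[x]_\alpha=\{y\in L: x=_\alpha y\}$. For a set $X$, $X\sqsubseteq_\alpha y$ means $x\sqsubseteq_\alpha y$ for all $x\in X$. The structure is a model of Axioms 1–4 if: - (A1) for all $\alpha<\beta<\kappa$, $x\sqsubseteq_\beta y$ implies $x=_\alpha y$; - (A2) $\bigcap_{\alpha<\kappa}=_\alpha$ is the identity relation on $L$; - (A3) for every $x\in L$, every $\alpha<\kappa$ and every $X\subseteq(x]_\alpha$ there is $y\in(x]_\alpha$ with $X\sqsubseteq_\alpha y$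 such that for all $z\in(x]_\alpha$ with $X\sqsubseteq_\alpha z$ we have $y\sqsubseteq_\alpha z$ and $y\le z$; - (A4) for every nonempty $X\subseteq L$, every $\alpha<\kappa$ and every $y\in L$, if $y=_\alpha x$ for all $x\in X$ then $y=_\alpha\bigvee X$. -}

module Defs where

open import Level using (Level; suc)
open import Data.Product using (∃; _×_)
open import Data.Sum using (_⊎_)
open import Induction.WellFounded using (WellFounded)
open import Relation.Binary.Core using (Rel)
open import Relation.Binary.Structures using (IsPartialOrder; IsPreorder; IsStrictTotalOrder)
open import Relation.Binary.PropositionalEquality using (_≡_)
open import Relation.Nullary using (¬_)
open import Relation.Unary using (Pred; _∈_; _⊆_; Satisfiable)
open import Relation.Unary.Polymorphic using (∅)

-- A single level ℓ plays the role of the universe of sets: carriers, relations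
-- and subsets (predicates) all live there.

module _ {ℓ : Level} {A : Set ℓ} (_≤_ : Rel A ℓ) where

  record IsLub (X : Pred A ℓ) (y : A) : Set ℓ where
    field
      upper : ∀ {x} → x ∈ X → x ≤ y
      least : ∀ z → (∀ {x} → x ∈ X → x ≤ z) → y ≤ z

  record IsGlb (X : Pred A ℓ) (y : A) : Set ℓ where
    field
      lower    : ∀ {x} → x ∈ X → y ≤ x
      greatest : ∀ z → (∀ {x} → x ∈ X → z ≤ x) → z ≤ y

  record IsCompleteLattice : Set (suc ℓ) where
    field
      isPartialOrder : IsPartialOrder _≡_ _≤_
      ⋁              : Pred A ℓ → A
      ⋁-isLub        : ∀ X → IsLub X (⋁ X)
      ⋀              : Pred A ℓ → A
      ⋀-isGlb        : ∀ X → IsGlb X (⋀ X)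

    ⊥ : A
    ⊥ = ⋁ ∅

-- An ordinal κ is represented by a well-ordered set; the elements of Below
-- are the ordinals α < κ.

record Ordinal (ℓ : Level) : Set (suc ℓ) where
  infix 4 _<_
  field
    Below              : Set ℓ
    _<_                : Rel Below ℓ
    isStrictTotalOrder : IsStrictTotalOrder _≡_ _<_
    wellFounded        : WellFounded _<_

module Derived {ℓ : Level} (κ : Ordinal ℓ) {L : Set ℓ}
               (_⊑[_]_ : L → Ordinal.Below κ → L → Set ℓ) where
  open Ordinal κ

  infix 4 _=[_]_ _⊏[_]_ _⊏_ _⊑_ _⊑ˢ[_]_

  _=[_]_ : L → Below → L → Set ℓ
  x =[ α ] y = (x ⊑[ α ] y) × (y ⊑[ α ] x)

  _⊏[_]_ : L → Below → L → Set ℓ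
  x ⊏[ α ] y = (x ⊑[ α ] y) × ¬ (x =[ α ] y)

  _⊏_ : Rel L ℓ
  x ⊏ y = ∃ λ α → x ⊏[ α ] y

  _⊑_ : Rel L ℓ
  x ⊑ y = (x ⊏ y) ⊎ (x ≡ y)

  -- The set (x]_α.
  ⦅_]_ : L → Below → Pred L ℓ
  (⦅ x ] α) y = ∀ β → β < α → x =[ β ] y

  _⊑ˢ[_]_ : Pred L ℓ → Below → L → Set ℓ
  X ⊑ˢ[ α ] y = ∀ {x} → x ∈ X → x ⊑[ α ] y

record Model (ℓ : Level) : Set (suc ℓ) where
  infix 4 _≤_ _⊑[_]_
  field
    L                 : Set ℓ
    _≤_               : Rel L ℓ
    isCompleteLattice : IsCompleteLattice _≤_
    κ                 : Ordinal ℓ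

  open IsCompleteLattice isCompleteLattice public using (⋁; ⊥)
  open Ordinal κ public using (Below; _<_)

  field
    κ>0        : Below
    _⊑[_]_     : L → Below → L → Set ℓ
    isPreorder : ∀ α → IsPreorder _≡_ (λ x y → x ⊑[ α ] y)

  open Derived κ _⊑[_]_ public

  field
    axiom1 : ∀ {α β} → α < β → ∀ {x y} → x ⊑[ β ] y → x =[ α ] y
    -- The converse inclusion is reflexivity of each ⊑[ α ].
    axiom2 : ∀ {x y} → (∀ α → x =[ α ] y) → x ≡ y
    axiom3 : ∀ x α (X : Pred L ℓ) → X ⊆ ⦅ x ] α →
             ∃ λ y → y ∈ ⦅ x ] α × X ⊑ˢ[ α ] y ×
               (∀ z → z ∈ ⦅ x ] α → X ⊑ˢ[ α ] z → y ⊑[ α ] z × y ≤ z)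
    axiom4 : ∀ (X : Pred L ℓ) → Satisfiable X → ∀ α y →
             (∀ {x} → x ∈ X → y =[ α ] x) → y =[ α ] ⋁ X

{-# OPTIONS --safe #-}

-- The order ⊑ is the intersection of its truncations ≼[ α ], where x ≼[ α ] y
-- means that x ⊏[ δ ] y for some δ ≤ α, or x =[ α ] y.  By well-founded
-- induction on α one finds, for a set X, an element x_α that is a least upper
-- bound of X for every ≼[ β ] with β ≤ α: take w with w =[ β ] x_β for all
-- β < α, and let x_α be the element given by Axiom 3 for the set of those
-- elements of X that lie in (w]_α.  Such an element w exists because Axiom 3
-- makes x_α ≤-minimal in its =[ α ]-class; hence the x_β increase for ≤, their
-- join is the join of any tail, and Axiom 4 applies to the tails.  The join of
-- all the x_α is the least upper bound of X for ⊑.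
module Submission where

open import Defs
open import Level using (Level)
open import Axiom.ExcludedMiddle using (ExcludedMiddle)
open import Data.Empty using (⊥-elim)
open import Data.Product using (∃; _×_; _,_; proj₁; proj₂)
open import Data.Sum using (_⊎_; inj₁; inj₂)
open import Induction.WellFounded using (module All)
open import Relation.Binary.Core using (Rel)
open import Relation.Binary.Definitions using (tri<; tri≈; tri>)
open import Relation.Binary.PropositionalEquality using (_≡_; refl; subst; isEquivalence)
open import Relation.Binary.Structures using (IsPartialOrder; IsPreorder; IsStrictTotalOrder)
open import Relation.Nullary using (¬_; yes; no)
open import Relation.Unary using (Pred; Satisfiable; _∈_; _∩_)
open import Relation.Unary.Polymorphic using (∅; U)

module _ {ℓ : Level} {A : Set ℓ} {_≤_ : Rel A ℓ} where

  -- The meet of a set is the join of its lower bounds.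
  lubs⇒isCompleteLattice : IsPartialOrder _≡_ _≤_ →
                           (∀ (X : Pred A ℓ) → ∃ (IsLub _≤_ X)) →
                           IsCompleteLattice _≤_
  lubs⇒isCompleteLattice po lub = record
    { isPartialOrder = po
    ; ⋁ = λ X → proj₁ (lub X)
    ; ⋁-isLub = λ X → proj₂ (lub X)
    ; ⋀ = λ X → proj₁ (lub (LowerBound X))
    ; ⋀-isGlb = λ X → record
        { lower = λ x∈X → IsLub.least (proj₂ (lub (LowerBound X))) _ (λ l → l x∈X)
        ; greatest = λ z l → IsLub.upper (proj₂ (lub (LowerBound X))) l
        }
    }
    where
    LowerBound : Pred A ℓ → Pred A ℓ
    LowerBound X z = ∀ {x} → x ∈ X → z ≤ x

module Properties {ℓ : Level} (em : ExcludedMiddle ℓ) (M : Model ℓ) where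
  open Model M
  open IsStrictTotalOrder (Ordinal.isStrictTotalOrder κ)
    using (compare) renaming (trans to <-trans)
  open IsCompleteLattice isCompleteLattice using (⋁-isLub)
  open IsPartialOrder (IsCompleteLattice.isPartialOrder isCompleteLattice)
    using () renaming (antisym to ≤-antisym; trans to ≤-trans)

  -- Truncated orders

  infix 4 _≲_ _≺[_]_ _≼[_]_

  _≲_ : Rel Below ℓ
  β ≲ α = (β < α) ⊎ (β ≡ α)

  ≲-trans : ∀ {α β γ} → α ≲ β → β ≲ γ → α ≲ γ
  ≲-trans (inj₁ p)    (inj₁ q)    = inj₁ (<-trans p q)
  ≲-trans (inj₁ p)    (inj₂ refl) = inj₁ p
  ≲-trans (inj₂ refl) q           = q

  ≲-or-> : ∀ α β → (α ≲ β) ⊎ (β < α)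
  ≲-or-> α β with compare α β
  ... | tri< p _ _ = inj₁ (inj₁ p)
  ... | tri≈ _ p _ = inj₁ (inj₂ p)
  ... | tri> _ _ p = inj₂ p

  ⊑ₐ-trans : ∀ {α x y z} → x ⊑[ α ] y → y ⊑[ α ] z → x ⊑[ α ] z
  ⊑ₐ-trans {α} = IsPreorder.trans (isPreorder α)

  =ₐ-refl : ∀ {α x} → x =[ α ] x
  =ₐ-refl {α} = IsPreorder.refl (isPreorder α) , IsPreorder.refl (isPreorder α)

  =ₐ-sym : ∀ {α x y} → x =[ α ] y → y =[ α ] x
  =ₐ-sym (p , q) = q , p

  =ₐ-trans : ∀ {α x y z} → x =[ α ] y → y =[ α ] z → x =[ α ] z
  =ₐ-trans (p , q) (r , s) = ⊑ₐ-trans p r , ⊑ₐ-trans s q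

  =ₐ-down : ∀ {α β x y} → β ≲ α → x =[ α ] y → x =[ β ] y
  =ₐ-down (inj₁ β<α)  (p , _) = axiom1 β<α p
  =ₐ-down (inj₂ refl) p       = p

  ⊏-⊑-trans : ∀ {α x y z} → x ⊏[ α ] y → y ⊑[ α ] z → x ⊏[ α ] z
  ⊏-⊑-trans (p , n) q = ⊑ₐ-trans p q , λ (_ , r) → n (p , ⊑ₐ-trans q r)

  ⊑-⊏-trans : ∀ {α x y z} → x ⊑[ α ] y → y ⊏[ α ] z → x ⊏[ α ] z
  ⊑-⊏-trans p (q , n) = ⊑ₐ-trans p q , λ (_ , r) → n (q , ⊑ₐ-trans r p)

  ⊑ₐ⇒⊏⊎= : ∀ {α x y} → x ⊑[ α ] y → (x ⊏[ α ] y) ⊎ (x =[ α ] y)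
  ⊑ₐ⇒⊏⊎= {α} {x} {y} p with em {x =[ α ] y}
  ... | yes e = inj₂ e
  ... | no ¬e = inj₁ (p , ¬e)

  _≺[_]_ : L → Below → L → Set ℓ
  x ≺[ α ] y = ∃ λ δ → (δ ≲ α) × (x ⊏[ δ ] y)

  _≼[_]_ : L → Below → L → Set ℓ
  x ≼[ α ] y = (x ≺[ α ] y) ⊎ (x =[ α ] y)

  ≺-weaken : ∀ {α β x y} → β ≲ α → x ≺[ β ] y → x ≺[ α ] y
  ≺-weaken β≲α (δ , δ≲β , p) = δ , ≲-trans δ≲β β≲α , p

  ≺-irrefl : ∀ {α x} → ¬ (x ≺[ α ] x)
  ≺-irrefl (_ , _ , _ , n) = n =ₐ-refl

  -- The smaller of the two indices decides: by Axiom 1 the comparison at the larger index is an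
  -- equality there.
  ≺-≼-trans : ∀ {α x y z} → x ≺[ α ] y → y ≼[ α ] z → x ≺[ α ] z
  ≺-≼-trans (δ , δ≲α , p) (inj₂ e) = δ , δ≲α , ⊏-⊑-trans p (proj₁ (=ₐ-down δ≲α e))
  ≺-≼-trans (δ , δ≲α , p) (inj₁ (ε , ε≲α , q)) with compare δ ε
  ... | tri< δ<ε _ _  = δ , δ≲α , ⊏-⊑-trans p (proj₁ (axiom1 δ<ε (proj₁ q)))
  ... | tri≈ _ refl _ = δ , δ≲α , ⊏-⊑-trans p (proj₁ q)
  ... | tri> _ _ ε<δ  = ε , ε≲α , ⊑-⊏-trans (proj₁ (axiom1 ε<δ (proj₁ p))) q

  =-≼-trans : ∀ {α x y z} → x =[ α ] y → y ≼[ α ] z → x ≼[ α ] z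
  =-≼-trans e (inj₁ (δ , δ≲α , q)) = inj₁ (δ , δ≲α , ⊑-⊏-trans (proj₁ (=ₐ-down δ≲α e)) q)
  =-≼-trans e (inj₂ f)             = inj₂ (=ₐ-trans e f)

  ≼-trans : ∀ {α x y z} → x ≼[ α ] y → y ≼[ α ] z → x ≼[ α ] z
  ≼-trans (inj₁ p) q = inj₁ (≺-≼-trans p q)
  ≼-trans (inj₂ e) q = =-≼-trans e q

  ≼-antisym : ∀ {α x y} → x ≼[ α ] y → y ≼[ α ] x → x =[ α ] y
  ≼-antisym (inj₁ p) q = ⊥-elim (≺-irrefl (≺-≼-trans p q))
  ≼-antisym (inj₂ e) _ = e

  ≼∧≠⇒≺ : ∀ {α x y} → x ≼[ α ] y → ¬ (x =[ α ] y) → x ≺[ α ] y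
  ≼∧≠⇒≺ (inj₁ p) _ = p
  ≼∧≠⇒≺ (inj₂ e) n = ⊥-elim (n e)

  ⊏⇒≼ : ∀ {α δ x y} → x ⊏[ δ ] y → x ≼[ α ] y
  ⊏⇒≼ {α} {δ} p with ≲-or-> δ α
  ... | inj₁ δ≲α = inj₁ (δ , δ≲α , p)
  ... | inj₂ α<δ = inj₂ (axiom1 α<δ (proj₁ p))

  ≼-down : ∀ {α β x y} → β ≲ α → x ≼[ α ] y → x ≼[ β ] y
  ≼-down β≲α (inj₁ (_ , _ , p)) = ⊏⇒≼ p
  ≼-down β≲α (inj₂ e)           = inj₂ (=ₐ-down β≲α e)

  ⊑ₐ⇒≼ : ∀ {α x y} → x ⊑[ α ] y → x ≼[ α ] y
  ⊑ₐ⇒≼ {α} p with ⊑ₐ⇒⊏⊎= p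
  ... | inj₁ q = inj₁ (α , inj₂ refl , q)
  ... | inj₂ e = inj₂ e

  -- Agreement below `α` rules out a strict comparison at any `δ < α`, so only the index `α` itself
  -- is left.
  ≼∧∈⦅]⇒⊑ₐ : ∀ {α x y} → y ∈ ⦅ x ] α → x ≼[ α ] y → x ⊑[ α ] y
  ≼∧∈⦅]⇒⊑ₐ h (inj₁ (δ , inj₁ δ<α , _ , n))  = ⊥-elim (n (h δ δ<α))
  ≼∧∈⦅]⇒⊑ₐ h (inj₁ (δ , inj₂ refl , p , _)) = p
  ≼∧∈⦅]⇒⊑ₐ h (inj₂ (p , _))                 = p

  -- If x and y already differ below α, then they differ at some β < α, and
  -- that difference decides the comparison at α.
  ≼-from-below : ∀ {α x y} → (∀ β → β < α → x ≼[ β ] y) →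
                 (y ∈ ⦅ x ] α → x ⊑[ α ] y) → x ≼[ α ] y
  ≼-from-below {α} {x} {y} below agree with em {∃ λ β → (β < α) × ¬ (x =[ β ] y)}
  ... | yes (β , β<α , n) = inj₁ (≺-weaken (inj₁ β<α) (≼∧≠⇒≺ (below β β<α) n))
  ... | no none = ⊑ₐ⇒≼ (agree equal)
    where
    equal : ∀ β → β < α → x =[ β ] y
    equal β β<α with em {x =[ β ] y}
    ... | yes e = e
    ... | no ¬e = ⊥-elim (none (β , β<α , ¬e))

  ⊑⇒≼ : ∀ {α x y} → x ⊑ y → x ≼[ α ] y
  ⊑⇒≼ (inj₁ (_ , p)) = ⊏⇒≼ p
  ⊑⇒≼ (inj₂ refl)    = inj₂ =ₐ-refl

  -- If `x ⊏ y` fails, no truncation can hold strictly; all of them are then equalities and Axiom 2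
  -- applies.
  ≼⇒⊑ : ∀ {x y} → (∀ α → x ≼[ α ] y) → x ⊑ y
  ≼⇒⊑ {x} {y} h with em {x ⊏ y}
  ... | yes p = inj₁ p
  ... | no ¬p = inj₂ (axiom2 λ α → equal (h α))
    where
    equal : ∀ {α} → x ≼[ α ] y → x =[ α ] y
    equal (inj₁ (δ , _ , p)) = ⊥-elim (¬p (δ , p))
    equal (inj₂ e)           = e

  ⊑-isPartialOrder : IsPartialOrder _≡_ _⊑_
  ⊑-isPartialOrder = record
    { isPreorder = record
        { isEquivalence = isEquivalence
        ; reflexive = inj₂
        ; trans = λ p q → ≼⇒⊑ λ _ → ≼-trans (⊑⇒≼ p) (⊑⇒≼ q)
        }
    ; antisym = λ p q → axiom2 λ _ → ≼-antisym (⊑⇒≼ p) (⊑⇒≼ q)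
    }

  -- The least element

  ⊥-≤ : ∀ {x} → ⊥ ≤ x
  ⊥-≤ {x} = IsLub.least (⋁-isLub ∅) x λ ()

  -- Axiom 3 for the empty set gives a least element of `⦅ ⊥ ] α` for both orders. As `⊥` lies in
  -- that set, this element is `≤ ⊥`, hence is `⊥`.
  ⊥-⊑ₐ : ∀ {α z} → z ∈ ⦅ ⊥ ] α → ⊥ ⊑[ α ] z
  ⊥-⊑ₐ {α} {z} z∈ with axiom3 ⊥ α ∅ (λ ())
  ... | y , _ , _ , least = subst (_⊑[ α ] z) y≡⊥ (proj₁ (least z z∈ λ ()))
    where
    y≡⊥ : y ≡ ⊥
    y≡⊥ = ≤-antisym (proj₂ (least ⊥ (λ _ _ → =ₐ-refl) λ ())) ⊥-≤

  ⊥-⊑ : ∀ x → ⊥ ⊑ x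
  ⊥-⊑ x = ≼⇒⊑ (All.wfRec (Ordinal.wellFounded κ) ℓ (λ α → ⊥ ≼[ α ] x)
                 λ α rec → ≼-from-below (λ β β<α → rec β<α) ⊥-⊑ₐ)

  -- Limits of coherent families

  IsClassMinimum : Below → Pred L ℓ
  IsClassMinimum α x = ∀ {z} → x =[ α ] z → x ≤ z

  module _ {I : Pred Below ℓ} (f : ∀ β → β ∈ I → L)
           (coherent : ∀ {β γ} (i : β ∈ I) (j : γ ∈ I) → β ≲ γ → f β i =[ β ] f γ j)
           (minimum : ∀ {β} (i : β ∈ I) → IsClassMinimum β (f β i)) where

    private
      Range : Pred L ℓ
      Range z = ∃ λ β → ∃ λ (i : β ∈ I) → z ≡ f β i

      Tail : Below → Pred L ℓ
      Tail β z = ∃ λ γ → ∃ λ (j : γ ∈ I) → (β ≲ γ) × (z ≡ f γ j)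

    limit : L
    limit = ⋁ Range

    limit-= : ∀ {β} (i : β ∈ I) → f β i =[ β ] limit
    limit-= {β} i = subst (f β i =[ β ]_) tail≡limit
      (axiom4 (Tail β) (f β i , β , i , inj₂ refl , refl) β (f β i)
        λ { (γ , j , β≲γ , refl) → coherent i j β≲γ })
      where
      range≤tail : ∀ {z} → z ∈ Range → z ≤ ⋁ (Tail β)
      range≤tail (γ , j , refl) with ≲-or-> β γ
      ... | inj₁ β≲γ = IsLub.upper (⋁-isLub (Tail β)) (γ , j , β≲γ , refl)
      -- An earlier member is `=[ γ ]` to `f β i` by coherence, and being minimal in its class it is
      -- `≤ f β i`, which is in the tail.
      ... | inj₂ γ<β = ≤-trans (minimum j (coherent j i (inj₁ γ<β)))
                         (IsLub.upper (⋁-isLub (Tail β)) (β , i , inj₂ refl , refl))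

      tail≡limit : ⋁ (Tail β) ≡ limit
      tail≡limit = ≤-antisym
        (IsLub.least (⋁-isLub (Tail β)) _
          λ (γ , j , _ , e) → IsLub.upper (⋁-isLub Range) (γ , j , e))
        (IsLub.least (⋁-isLub Range) _ range≤tail)

  -- Least upper bounds for the truncations

  IsLubₐ : Below → Pred L ℓ → L → Set ℓ
  IsLubₐ α = IsLub (λ x y → x ≼[ α ] y)

  lubₐ-unique : ∀ {α X x y} → IsLubₐ α X x → IsLubₐ α X y → x =[ α ] y
  lubₐ-unique p q =
    ≼-antisym (IsLub.least p _ (IsLub.upper q)) (IsLub.least q _ (IsLub.upper p))

  lubₐ-resp-= : ∀ {α X x y} → x =[ α ] y → IsLubₐ α X x → IsLubₐ α X y
  lubₐ-resp-= e p = record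
    { upper = λ x∈X → ≼-trans (IsLub.upper p x∈X) (inj₂ e)
    ; least = λ z u → =-≼-trans (=ₐ-sym e) (IsLub.least p z u)
    }

  module _ (X : Pred L ℓ) where

    -- A least upper bound for ≼[ α ] need not be one for the coarser ≼[ β ],
    -- so all β ≤ α are demanded.
    record Approximant (α : Below) : Set ℓ where
      field
        value   : L
        minimum : IsClassMinimum α value
        isLub   : ∀ {β} → β ≲ α → IsLubₐ β X value

    open Approximant

    approximants-coherent : ∀ {β γ} (a : Approximant β) (b : Approximant γ) →
                            β ≲ γ → value a =[ β ] value b
    approximants-coherent a b β≲γ = lubₐ-unique (isLub a (inj₂ refl)) (isLub b β≲γ)

    extend : ∀ {α} w → (∀ β → β < α → IsLubₐ β X w) → Approximant α
    extend {α} w w-lub with axiom3 w α (X ∩ ⦅ w ] α) proj₂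
    ... | y , y∈ , y-upper , y-least = record
      { value = y
      -- Any `z` with `y =[ α ] z` is again in `⦅ w ] α` and bounds the same set, so the `≤` clause
      -- of Axiom 3 applies to it.
      ; minimum = λ {z} y=z → proj₂ (y-least z
          (λ β β<α → =ₐ-trans (y∈ β β<α) (=ₐ-down (inj₁ β<α) y=z))
          (λ x∈ → ⊑ₐ-trans (y-upper x∈) (proj₁ y=z)))
      ; isLub = λ where
          (inj₁ β<α)  → y-lub-below _ β<α
          (inj₂ refl) → record
            { upper = λ x∈X → ≼-from-below
                (λ β β<α → IsLub.upper (y-lub-below β β<α) x∈X)
                -- An element of `X` that agrees with `y` below `α` also agrees with `w` there, so
                -- it is in the set given to Axiom 3.
                (λ y∈x → y-upper (x∈X , λ β β<α →
                  =ₐ-trans (y∈ β β<α) (=ₐ-sym (y∈x β β<α))))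
            ; least = λ z u → ≼-from-below
                (λ β β<α → IsLub.least (y-lub-below β β<α) z
                             λ x∈X → ≼-down (inj₁ β<α) (u x∈X))
                -- Here `z` and the elements of `X ∩ ⦅ w ] α` all agree with `w` below `α`, so the
                -- bound `≼[ α ]` sharpens to `⊑[ α ]`, as Axiom 3 requires.
                (λ z∈y → let z∈w = λ β β<α → =ₐ-trans (y∈ β β<α) (z∈y β β<α) in
                  proj₁ (y-least z z∈w λ (x∈X , x∈w) → ≼∧∈⦅]⇒⊑ₐ
                    (λ β β<α → =ₐ-trans (=ₐ-sym (x∈w β β<α)) (z∈w β β<α)) (u x∈X)))
            }
      }
      where
      y-lub-below : ∀ β → β < α → IsLubₐ β X y
      y-lub-below β β<α = lubₐ-resp-= (y∈ β β<α) (w-lub β β<α)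

    module _ {I : Pred Below ℓ} (a : ∀ β → β ∈ I → Approximant β) where

      -- `I` is an initial segment in the recursion of `approximant` and all of `Below` in `⊑-lub`.
      -- For empty `I` the claim is vacuous, so the recursion has no separate base case.
      limit-approximants : ∃ λ w → ∀ β → β ∈ I → IsLubₐ β X w
      limit-approximants =
        limit f coherent (λ i → minimum (a _ i)) ,
        λ β i → lubₐ-resp-= (limit-= f coherent (λ j → minimum (a _ j)) i)
                            (isLub (a β i) (inj₂ refl))
        where
        f : ∀ β → β ∈ I → L
        f β i = value (a β i)

        coherent : ∀ {β γ} (i : β ∈ I) (j : γ ∈ I) → β ≲ γ → f β i =[ β ] f γ j
        coherent i j = approximants-coherent (a _ i) (a _ j)

    approximant : ∀ α → Approximant α
    approximant = All.wfRec (Ordinal.wellFounded κ) ℓ Approximant λ α rec →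
      let w , w-lub = limit-approximants (λ β β<α → rec β<α) in extend w w-lub

    ⊑-lub : ∃ (IsLub _⊑_ X)
    ⊑-lub with limit-approximants {I = U} (λ β _ → approximant β)
    ... | x , x-lub = x , record
      { upper = λ x∈X → ≼⇒⊑ λ α → IsLub.upper (x-lub α _) x∈X
      ; least = λ z u → ≼⇒⊑ λ α → IsLub.least (x-lub α _) z λ x∈X → ⊑⇒≼ (u x∈X)
      }

mainTheorem1 : ∀ {ℓ : Level} → ExcludedMiddle ℓ → (M : Model ℓ) →
    let open Model M in
    IsCompleteLattice _⊑_
    × (∀ x → ⊥ ⊑ x)
    × (∀ (X : Pred L ℓ) → Satisfiable X → ∃ λ y → IsLub _⊑_ X y)
mainTheorem1 em M =
  lubs⇒isCompleteLattice ⊑-isPartialOrder ⊑-lub , ⊥-⊑ , λ X _ → ⊑-lub X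
  where open Properties em M
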